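{- There is an absolute constant $C>0$ such that for every integer $n\geq 1$ there exists a connected graph $G$ with $n$ vertices and at most $C\cdot n\cdot L(n)$ edges satisfying $b_{\mathsf{fa}}(G)=\lceil\log_2 n\rceil$, i.e., there is a collection of lists $(\ell_v)_{v\in V(G)}$ such that, in the fully-adaptive source-oblivious model, broadcast from every source vertex completes in $\lceil\log_2 n\rceil$ rounds.
   Context: For a positive integer $x$, $L(x)$ denotes the number of consecutive leading 1s in the binary representation of $x-1$ (e.g. $L(12)=1$ since $11=(1011)_2$). Broadcasting in a connected graph $G$: initially only a source vertex $s$ holds a message; time proceeds in synchronous rounds, and in each round every informed vertex may transmit the message to at most one of its neighbors. Fully-adaptive source-oblivious model: each vertex $v$ is assigned a single ordered list $\ell_v=(u_1,\dots,u_k)$ of distinct neighbors of $v$ (independent of the source). Once $v$ is informed, in each subsequent round it sends the message to the first vertex of $\ell_v$ that is not already informed at the start of that round (informed neighbors are skipped); $v$ stops when all vertices in its list are informed. For a family of lists $L=(\ell_v)_{v\in V(G)}$ and a source $s$, $b_{\mathsf{fa}}(G,s,L)$ denotes the number of rounds until all vertices are informed, and $b_{\mathsf{fa}}(G)=\min_L\max_{s\in V(G)} b_{\mathsf{fa}}(G,s,L)$. -}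

module Defs where

open import Data.Nat using (ℕ; zero; suc; _+_; _*_; _∸_; _≡ᵇ_; _≤_)
open import Data.Nat.DivMod using (_/_; _%_)
open import Data.Bool using (Bool; true; false; _∧_; _∨_; not; T)
open import Data.Fin using (Fin; _≟_; toℕ; _<_)
open import Data.List using (List; []; _∷_; reverse; length; filter)
open import Data.List.Base using (cartesianProduct)
open import Data.Bool.ListAction using (any)
open import Data.List.Relation.Unary.All using (All)
open import Data.List.Relation.Unary.Unique.Propositional using (Unique)
open import Data.Fin.Base using ()
open import Data.List.Base using (allFin)
open import Data.Maybe using (Maybe; just; nothing)
open import Data.Product using (Σ; _×_; _,_; proj₁; proj₂)
open import Relation.Nullary.Decidable using (⌊_⌋)
open import Relation.Binary.PropositionalEquality using (_≡_)
open import Relation.Binary.Construct.Closure.ReflexiveTransitive using (Star)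

bitsLSB : ℕ → ℕ → List Bool
bitsLSB zero    _       = []
bitsLSB (suc f) zero    = []
bitsLSB (suc f) (suc m) = ((suc m % 2) ≡ᵇ 1) ∷ bitsLSB f (suc m / 2)

-- most-significant-bit-first binary representation (no leading zeros);
-- fuel m is enough since m has at most m binary digits
binary : ℕ → List Bool
binary m = reverse (bitsLSB m m)

leadingOnes : List Bool → ℕ
leadingOnes []          = 0
leadingOnes (true ∷ bs) = suc (leadingOnes bs)
leadingOnes (false ∷ _) = 0

Lfun : ℕ → ℕ
Lfun x = leadingOnes (binary (x ∸ 1))

record Graph (n : ℕ) : Set where
  field
    adj       : Fin n → Fin n → Bool
    symmetric : ∀ u v → adj u v ≡ adj v u
    irrefl    : ∀ v → adj v v ≡ false
open Graph public

Adj : ∀ {n} → Graph n → Fin n → Fin n → Set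
Adj G u v = T (adj G u v)

Connected : ∀ {n} → Graph n → Set
Connected G = ∀ u v → Star (Adj G) u v

numEdges : ∀ {n} → Graph n → ℕ
numEdges {n} G =
  length (filter (λ p → adj G (proj₁ p) (proj₂ p) Data.Bool.≟ true)
                 (filter (λ p → proj₁ p Data.Fin.<? proj₂ p)
                         (cartesianProduct (allFin n) (allFin n))))

record ListFamily {n : ℕ} (G : Graph n) : Set where
  field
    lst      : Fin n → List (Fin n)
    neigh    : ∀ v → All (Adj G v) (lst v)
    distinct : ∀ v → Unique (lst v)
open ListFamily public

Informed : ℕ → Set
Informed n = Fin n → Bool

firstUninformed : ∀ {n} → Informed n → List (Fin n) → Maybe (Fin n)
firstUninformed I []       = nothing
firstUninformed I (u ∷ us) with I u
... | true  = firstUninformed I us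
... | false = just u

sendsTo : ∀ {n} → Maybe (Fin n) → Fin n → Bool
sendsTo nothing  u = false
sendsTo (just w) u = ⌊ w ≟ u ⌋

step : ∀ {n} {G : Graph n} → ListFamily G → Informed n → Informed n
step {n} ℓ I u =
  I u ∨ any (λ v → I v ∧ sendsTo (firstUninformed I (lst ℓ v)) u) (allFin n)

informedAfter : ∀ {n} {G : Graph n} → ListFamily G → Fin n → ℕ → Informed n
informedAfter {n} ℓ s zero    u = ⌊ s ≟ u ⌋
informedAfter {n} ℓ s (suc t) = step ℓ (informedAfter ℓ s t)

CompletesBy : ∀ {n} {G : Graph n} → ListFamily G → Fin n → ℕ → Set
CompletesBy ℓ s t = ∀ u → informedAfter ℓ s t u ≡ true

-- b_fa(G) = k, i.e. min over list families of max over sources of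
-- b_fa(G,s,ℓ) equals k (b_fa(G,s,ℓ) may be infinite if broadcast never
-- completes; such families never witness a bound)
BfaEq : ∀ {n} → Graph n → ℕ → Set
BfaEq G k =
  (Σ (ListFamily G) λ ℓ → ∀ s → CompletesBy ℓ s k)
  × (∀ (ℓ : ListFamily G) (t : ℕ) → (∀ s → CompletesBy ℓ s t) → k ≤ t)

{-# OPTIONS --safe #-}

-- Let d = L(n) + 1, so that n ≤ (2^d − 1) 2^r with d + r = ⌈log₂ n⌉ unless n is a power of 2, where
-- the hypercube does.  Take the d-cube without its zero vertex as a core and hang a binomial tree of
-- depth r under every core vertex; every other vertex is joined to the d core vertices of weight one.
-- A source outside the core calls these first and thereby replaces the missing zero vertex.  For a
-- source in the core, let each core vertex first clear its set bits and then set its unset bits in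
-- increasing order: the only vertex that loses a call to the missing zero vertex runs one dimension
-- ahead from then on and compensates for it.  In both cases the core is informed after d rounds and
-- the trees after r more.

module Submission where

open import Defs
open import Data.Nat using
  (ℕ; zero; suc; _+_; _*_; _∸_; _^_; _≤_; _<_; _≥_; _>_; _≤?_; _<?_; z≤n; s≤s; ⌊_/2⌋; ⌈_/2⌉; pred;
   NonZero; ≢-nonZero; _≡ᵇ_; s≤s⁻¹)
open import Data.Nat.DivMod using
  (_/_; _%_; m≡m%n+[m/n]*n; m%n<n; m/n<m; m<n*o⇒m/o<n; [m+kn]%n≡m%n; m<n⇒m%n≡m; m<n⇒m/n≡0;
   m*n/n≡m; +-distrib-/-∣ʳ; m≥n⇒m/n>0)
open import Data.Nat.Divisibility using (divides-refl)
open import Data.Nat.Properties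
open import Data.Bool using (Bool; true; false; _∧_; not; T; if_then_else_)
import Data.Bool as Bool
import Data.Bool.Properties as Boolₚ
open import Data.Bool.ListAction using (any)
open import Data.Fin using (Fin; toℕ; fromℕ<)
import Data.Fin as Fin
open import Data.Fin.Properties using (toℕ<n; toℕ-injective; toℕ-fromℕ<)
open import Data.List using
  (List; []; _∷_; _++_; map; filter; length; reverse; _∷ʳ_; upTo; applyUpTo; allFin; concatMap;
   deduplicate; cartesianProduct)
open import Data.List.Properties using
  (length-++; length-map; length-applyUpTo; length-tabulate; unfold-reverse; filter-accept)
open import Data.List.Membership.Propositional using (_∈_; find; lose)
open import Data.List.Membership.Propositional.Properties
open import Data.List.Relation.Unary.All as All using (All; []; _∷_)
import Data.List.Relation.Unary.All.Properties as Allₚ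
open import Data.List.Relation.Unary.AllPairs using ([]; _∷_)
open import Data.List.Relation.Unary.Any as Any using (here; there)
open import Data.List.Relation.Unary.First as First using (First; [_]; _∷_)
open import Data.List.Relation.Unary.Unique.Propositional using (Unique)
import Data.List.Relation.Unary.Unique.Propositional.Properties as Uniqueₚ
import Data.List.Relation.Unary.Unique.DecPropositional.Properties as DecUniqueₚ
open import Data.Maybe using (just; fromMaybe)
open import Data.Nat.Solver using (module +-*-Solver)
open import Data.Nat.Logarithm using (⌈log₂_⌉; ⌈log₂⌉-mono-≤; ⌈log₂2^n⌉≡n; ⌈log₂⌈n/2⌉⌉≡⌈log₂n⌉∸1)
import Data.Product.Properties as Productₚ
open import Data.Product using (Σ; ∃; _×_; _,_; proj₁; proj₂)
open import Data.Sum as Sum using (_⊎_; inj₁; inj₂)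
open import Data.Vec as Vec using (Vec; []; _∷_)
import Data.Vec.Properties as Vecₚ
open import Function using (_∘_; id)
open import Function.Bundles using (mk⇔)
open import Relation.Binary.Construct.Closure.ReflexiveTransitive using (Star; ε; _◅_; _◅◅_)
open import Relation.Binary.Definitions using (DecidableEquality; tri<; tri≈; tri>)
open import Relation.Binary.PropositionalEquality using
  (_≡_; _≢_; ≢-sym; refl; sym; trans; cong; cong₂; subst; subst₂; module ≡-Reasoning)
open import Relation.Nullary using (¬_; Dec; yes; no; contradiction; ¬?; _×-dec_; _⊎-dec_)
open import Relation.Nullary.Decidable using
  (does; does-⇔; toWitness; dec-true; dec-false; isYes≗does)

-- Lengths of lists, and entries reached after a prefix.

unique⊆⇒length≤ : ∀ {A : Set} {xs ys : List A} → Unique xs →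
                  (∀ {x} → x ∈ xs → x ∈ ys) → length xs ≤ length ys
unique⊆⇒length≤ {xs = []} _ _ = z≤n
unique⊆⇒length≤ {xs = x ∷ xs} (x∉xs ∷ uniq) xs⊆ys
  with as , bs , refl ← ∈-∃++ (xs⊆ys (here refl)) = begin
    suc (length xs)                ≤⟨ s≤s (unique⊆⇒length≤ uniq rest) ⟩
    suc (length (as ++ bs))        ≡⟨ cong suc (length-++ as) ⟩
    suc (length as + length bs)    ≡⟨ +-suc _ _ ⟨
    length as + suc (length bs)    ≡⟨ length-++ as ⟨
    length (as ++ x ∷ bs)          ∎
  where
  open ≤-Reasoning
  rest : ∀ {z} → z ∈ xs → z ∈ as ++ bs
  rest z∈xs with ∈-++⁻ as (xs⊆ys (there z∈xs))
  ... | inj₁ z∈as = ∈-++⁺ˡ z∈as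
  ... | inj₂ (here z≡x) = contradiction (sym z≡x) (All.lookup x∉xs z∈xs)
  ... | inj₂ (there z∈bs) = ∈-++⁺ʳ as z∈bs

injection⇒length≤ : ∀ {A B : Set} {xs : List A} {ys : List B} (h : A → B) →
                    (∀ {x y} → h x ≡ h y → x ≡ y) → Unique xs →
                    (∀ {x} → x ∈ xs → h x ∈ ys) → length xs ≤ length ys
injection⇒length≤ {xs = xs} {ys} h inj uniq xs⊆ys =
  subst (_≤ length ys) (length-map h xs) (unique⊆⇒length≤ (Uniqueₚ.map⁺ inj uniq) image)
  where
  image : ∀ {y} → y ∈ map h xs → y ∈ ys
  image y∈ with _ , x∈ , refl ← ∈-map⁻ h y∈ = xs⊆ys x∈

length-concatMap≤ : ∀ {A B : Set} (f : A → List B) {c} → (∀ x → length (f x) ≤ c) →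
                    ∀ xs → length (concatMap f xs) ≤ length xs * c
length-concatMap≤ f bound []       = z≤n
length-concatMap≤ f bound (x ∷ xs) =
  subst (_≤ _) (sym (length-++ (f x))) (+-mono-≤ (bound x) (length-concatMap≤ f bound xs))

module _ {A : Set} {P Q : A → Set} where

  First-++⁺ˡ : ∀ {xs ys} → First P Q xs → First P Q (xs ++ ys)
  First-++⁺ˡ [ q ]    = [ q ]
  First-++⁺ˡ (p ∷ ps) = p ∷ First-++⁺ˡ ps

  First-++⁺ʳ : ∀ {xs ys} → All P xs → First P Q ys → First P Q (xs ++ ys)
  First-++⁺ʳ []       f = f
  First-++⁺ʳ (p ∷ ps) f = p ∷ First-++⁺ʳ ps f

  -- Both halves of the list of a core vertex and its list of children have this shape; only smaller
  -- indices that pass the filter have to be skipped.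
  First-upTo : ∀ {C : ℕ → Set} (C? : ∀ i → Dec (C i)) (g : ℕ → A) {d m} → m < d → C m → Q (g m) →
               (∀ {i} → i < m → C i → P (g i)) → First P Q (map g (filter C? (upTo d)))
  First-upTo {C} C? g = go id
    where
    go : ∀ (h : ℕ → ℕ) {d m} → m < d → C (h m) → Q (g (h m)) →
         (∀ {i} → i < m → C (h i) → P (g (h i))) → First P Q (map g (filter C? (applyUpTo h d)))
    go h {suc d} {zero} _ c q _ rewrite filter-accept C? {xs = applyUpTo (h ∘ suc) d} c = [ q ]
    go h {suc d} {suc m} (s≤s m<d) c q before with C? (h 0)
    ... | yes c₀ = before (s≤s z≤n) c₀ ∷ go (h ∘ suc) m<d c q (before ∘ s≤s)
    ... | no _   = go (h ∘ suc) m<d c q (before ∘ s≤s)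

All-upTo : ∀ {A : Set} {P : A → Set} {C : ℕ → Set} (C? : ∀ i → Dec (C i)) (g : ℕ → A) {d} →
           (∀ {i} → i < d → C i → P (g i)) → All P (map g (filter C? (upTo d)))
All-upTo C? g {d} all = Allₚ.map⁺ (All.tabulate λ i∈ →
  let i∈upTo , c = ∈-filter⁻ C? {xs = upTo d} i∈ in all (∈-upTo⁻ i∈upTo) c)

-- The fully-adaptive model: whom a vertex calls, and the doubling bound.

module _ {n : ℕ} (I : Informed n) where

  Known : Fin n → Set
  Known v = I v ≡ true

  firstUninformed-first : ∀ {u xs} → First Known (_≡ u) xs → I u ≡ false → firstUninformed I xs ≡ just u
  firstUninformed-first [ refl ] u∉ rewrite u∉ = refl
  firstUninformed-first (p ∷ ps) u∉ rewrite p  = firstUninformed-first ps u∉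

  -- A vertex is informed whenever it calls, so with `v` the caller this allows a vertex to be
  -- struck from its own list. It also disposes of later copies of an informed entry.
  firstUninformed-drop : ∀ {v} → Known v → ∀ xs →
                         firstUninformed I (filter (¬? ∘ (v Fin.≟_)) xs) ≡ firstUninformed I xs
  firstUninformed-drop p [] = refl
  firstUninformed-drop {v} p (x ∷ xs) with v Fin.≟ x
  ... | yes refl rewrite p = firstUninformed-drop p xs
  ... | no _ with I x
  ...   | true  = firstUninformed-drop p xs
  ...   | false = refl

  -- A later copy of `x` is reached only if `x` is informed, and then it is skipped anyway.
  firstUninformed-deduplicate : ∀ xs → firstUninformed I (deduplicate Fin._≟_ xs) ≡ firstUninformed I xs
  firstUninformed-deduplicate [] = refl
  firstUninformed-deduplicate (x ∷ xs) with I x in p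
  ... | true  = trans (firstUninformed-drop p (deduplicate Fin._≟_ xs)) (firstUninformed-deduplicate xs)
  ... | false = refl

any⁺ : ∀ {A : Set} (p : A → Bool) {x xs} → x ∈ xs → p x ≡ true → any p xs ≡ true
any⁺ p (here refl) px rewrite px = refl
any⁺ p {xs = y ∷ _} (there x∈) px rewrite any⁺ p x∈ px = Boolₚ.∨-zeroʳ (p y)

any⁻ : ∀ {A : Set} (p : A → Bool) xs → any p xs ≡ true → ∃ λ x → p x ≡ true
any⁻ p (x ∷ xs) eq with p x in px
... | true  = x , px
... | false = any⁻ p xs eq

∧-true⁻ : ∀ {a b} → a ∧ b ≡ true → a ≡ true × b ≡ true
∧-true⁻ {true} {true} _ = refl , refl

≡true⇒T : ∀ {b} → b ≡ true → T b
≡true⇒T refl = _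

sendsTo⁻ : ∀ {n} m {u : Fin n} → sendsTo m u ≡ true → m ≡ just u
sendsTo⁻ (just w) {u} eq with w Fin.≟ u
... | yes refl = refl

firstUninformed∈ : ∀ {n} (I : Informed n) xs {u} → firstUninformed I xs ≡ just u → u ∈ xs
firstUninformed∈ I (x ∷ xs) eq with I x
... | true = there (firstUninformed∈ I xs eq)
firstUninformed∈ I (x ∷ xs) refl | false = here refl

module _ {n : ℕ} {G : Graph n} (ℓ : ListFamily G) where

  step-mono : ∀ I {u} → I u ≡ true → step ℓ I u ≡ true
  step-mono I p rewrite p = refl

  step-call : ∀ I {v u} → I v ≡ true → firstUninformed I (lst ℓ v) ≡ just u → step ℓ I u ≡ true
  step-call I {v} {u} Iv call with I u
  ... | true  = refl
  ... | false = any⁺ (λ w → I w ∧ sendsTo (firstUninformed I (lst ℓ w)) u) (∈-allFin v) sends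
    where
    sends : I v ∧ sendsTo (firstUninformed I (lst ℓ v)) u ≡ true
    sends rewrite Iv | call = trans (isYes≗does (u Fin.≟ u)) (dec-true (u Fin.≟ u) refl)

  step⁻ : ∀ I {u} → step ℓ I u ≡ true →
          I u ≡ true ⊎ ∃ λ v → I v ≡ true × firstUninformed I (lst ℓ v) ≡ just u
  step⁻ I {u} eq with I u
  ... | true  = inj₁ refl
  ... | false with any⁻ (λ w → I w ∧ sendsTo (firstUninformed I (lst ℓ w)) u) (allFin n) eq
  ...   | v , sends with Iv , s ← ∧-true⁻ sends = inj₂ (v , Iv , sendsTo⁻ (firstUninformed I (lst ℓ v)) s)

  start : ∀ s → informedAfter ℓ s 0 s ≡ true
  start s = trans (isYes≗does (s Fin.≟ s)) (dec-true (s Fin.≟ s) refl)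

  start⁻ : ∀ s {u} → informedAfter ℓ s 0 u ≡ true → s ≡ u
  start⁻ s {u} eq = toWitness {a? = s Fin.≟ u} (≡true⇒T eq)

  informed⇒reachable : ∀ s t {u} → informedAfter ℓ s t u ≡ true → Star (Adj G) s u
  informed⇒reachable s zero eq with refl ← start⁻ s eq = ε
  informed⇒reachable s (suc t) eq with step⁻ (informedAfter ℓ s t) eq
  ... | inj₁ old = informed⇒reachable s t old
  ... | inj₂ (v , Iv , call) = informed⇒reachable s t Iv ◅◅
          (All.lookup (neigh ℓ v) (firstUninformed∈ (informedAfter ℓ s t) (lst ℓ v) call) ◅ ε)

  -- Every informed vertex adds at most one vertex per round, so appending the callees to the list
  -- at most doubles what is needed. Repetitions are allowed, since only an upper bound is wanted.
  informedList : ∀ s t → Σ (List (Fin n)) λ xs →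
                 length xs ≡ 2 ^ t × (∀ {u} → informedAfter ℓ s t u ≡ true → u ∈ xs)
  informedList s zero = s ∷ [] , refl , λ eq → here (sym (start⁻ s eq))
  informedList s (suc t) with xs , len , complete ← informedList s t =
    xs ++ map callee xs , length-xs , complete′
    where
    I = informedAfter ℓ s t
    -- An idle vertex counts as its own callee, which keeps the length an exact power of two.
    callee = λ v → fromMaybe v (firstUninformed I (lst ℓ v))
    length-xs : length (xs ++ map callee xs) ≡ 2 ^ suc t
    length-xs rewrite length-++ xs {map callee xs} | length-map callee xs | len | +-identityʳ (2 ^ t) = refl
    complete′ : ∀ {u} → step ℓ I u ≡ true → u ∈ xs ++ map callee xs
    complete′ eq with step⁻ I eq
    ... | inj₁ old = ∈-++⁺ˡ (complete old)
    ... | inj₂ (v , Iv , call) = ∈-++⁺ʳ xs (subst (_∈ map callee xs) (cong (fromMaybe v) call)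
                                              (∈-map⁺ callee (complete Iv)))

  completes⇒≤2^ : ∀ s t → CompletesBy ℓ s t → n ≤ 2 ^ t
  completes⇒≤2^ s t complete with xs , len , mem ← informedList s t = begin
    n                 ≡⟨ length-tabulate id ⟨
    length (allFin n) ≤⟨ unique⊆⇒length≤ (Uniqueₚ.allFin⁺ n) (λ {u} _ → mem (complete u)) ⟩
    length xs         ≡⟨ len ⟩
    2 ^ t             ∎
    where open ≤-Reasoning

  completes-mono : ∀ {s t t′} → t ≤ t′ → CompletesBy ℓ s t → CompletesBy ℓ s t′
  completes-mono {s} {t} t≤t′ c with k , refl ← m≤n⇒∃[o]m+o≡n t≤t′ = later k {t} c
    where
    later : ∀ k {t} → CompletesBy ℓ s t → CompletesBy ℓ s (t + k)
    later zero {t} c rewrite +-identityʳ t = c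
    later (suc k) {t} c rewrite +-suc t k = later k {suc t} λ u → step-mono (informedAfter ℓ s t) (c u)

-- The message travels along edges, so completion yields connectedness. The doubling bound, applied
-- to one source, bounds every other list family from below.
bfaEq : ∀ {n} {G : Graph n} (ℓ : ListFamily G) {t} → n ≥ 1 → (∀ s → CompletesBy ℓ s t) → t ≤ ⌈log₂ n ⌉ →
        Connected G × BfaEq G ⌈log₂ n ⌉
bfaEq {suc n} ℓ {t} _ complete t≤ =
  (λ u v → informed⇒reachable ℓ u t (complete u v)) ,
  (ℓ , λ s → completes-mono ℓ t≤ (complete s)) ,
  λ ℓ′ t′ complete′ → subst (_ ≤_) (⌈log₂2^n⌉≡n t′)
    (⌈log₂⌉-mono-≤ (completes⇒≤2^ ℓ′ Fin.zero t′ (complete′ Fin.zero)))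

-- Networks given by vertex labels and sequences of labels to call.

module LabelledNetwork {W : Set} (_≟ᵂ_ : DecidableEquality W) {n : ℕ} (label : Fin n → W)
                       (label-injective : ∀ {f g} → label f ≡ label g → f ≡ g)
                       (calls : W → List W) where

  -- At most one vertex, and none for a label that is not in use. A call sequence may therefore
  -- mention absent vertices, such as the zero vector or tree nodes beyond `n`.
  vertices : W → List (Fin n)
  vertices w = filter (λ f → label f ≟ᵂ w) (allFin n)

  callees : Fin n → List (Fin n)
  callees f = concatMap vertices (calls (label f))

  Linked : Fin n → Fin n → Set
  Linked f g = f ≢ g × (label g ∈ calls (label f) ⊎ label f ∈ calls (label g))

  _∈?_ : ∀ w ws → Dec (w ∈ ws)
  w ∈? ws = Any.any? (w ≟ᵂ_) ws

  linked? : ∀ f g → Dec (Linked f g)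
  linked? f g = ¬? (f Fin.≟ g) ×-dec (label g ∈? calls (label f) ⊎-dec label f ∈? calls (label g))

  Linked-sym : ∀ {f g} → Linked f g → Linked g f
  Linked-sym (f≢g , l) = f≢g ∘ sym , Sum.swap l

  graph : Graph n
  adj       graph f g = does (linked? f g)
  symmetric graph f g = does-⇔ (mk⇔ Linked-sym Linked-sym) (linked? f g) (linked? g f)
  irrefl    graph f   = dec-false (linked? f f) λ (f≢f , _) → f≢f refl

  calls⇒Adj : ∀ {f g} → g ∈ callees f → f ≢ g → Adj graph f g
  calls⇒Adj {f} {g} g∈ f≢g with _ , w∈ , g∈w ← find (∈-concatMap⁻ vertices {xs = calls (label f)} g∈)
    with _ , refl ← ∈-filter⁻ (λ f → label f ≟ᵂ _) {xs = allFin n} g∈w =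
    ≡true⇒T (dec-true (linked? f g) (f≢g , inj₁ w∈))

  family : ListFamily graph
  -- Deduplicating and dropping the caller make any call sequence a legal list without changing the
  -- calls that are placed.
  lst      family f = filter (¬? ∘ (f Fin.≟_)) (deduplicate Fin._≟_ (callees f))
  neigh    family f = All.tabulate λ g∈ →
    let g∈dedup , f≢g = ∈-filter⁻ (¬? ∘ (f Fin.≟_)) {xs = deduplicate Fin._≟_ (callees f)} g∈
    in calls⇒Adj (∈-deduplicate⁻ Fin._≟_ (callees f) g∈dedup) f≢g
  distinct family f = Uniqueₚ.filter⁺ (¬? ∘ (f Fin.≟_)) (DecUniqueₚ.deduplicate-! Fin._≟_ (callees f))

  -- Labels carried by no vertex count as informed.
  Informedᴸ : Informed n → W → Set
  Informedᴸ I w = ∀ f → label f ≡ w → I f ≡ true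

  Used : W → Set
  Used w = ∃ λ f → label f ≡ w

  -- An informed label contributes informed vertices or none at all, so skipped labels become
  -- skipped vertices.
  first-callee : ∀ {I u ws} → First (Informedᴸ I) (_≡ label u) ws →
                 First (Known I) (_≡ u) (concatMap vertices ws)
  first-callee {I} {u} {w ∷ _} [ refl ] = First-++⁺ˡ (search (allFin n) (∈-allFin u))
    where
    search : ∀ fs → u ∈ fs → First (Known I) (_≡ u) (filter (λ f → label f ≟ᵂ label u) fs)
    search (f ∷ fs) u∈ with label f ≟ᵂ label u
    search (f ∷ fs) u∈           | yes eq = [ label-injective eq ]
    search (f ∷ fs) (here refl)  | no neq = contradiction refl neq
    search (f ∷ fs) (there u∈)   | no _   = search fs u∈
  first-callee (p ∷ ps) = First-++⁺ʳ
    (All.tabulate λ {f} f∈ → p f (proj₂ (∈-filter⁻ (λ f → label f ≟ᵂ _) {xs = allFin n} f∈)))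
    (first-callee ps)

  module Broadcast (s : Fin n) where

    record Inf (t : ℕ) (w : W) : Set where
      constructor inf
      field informed : Informedᴸ (informedAfter family s t) w
    open Inf public

    Inf-source : Inf 0 (label s)
    Inf-source .informed f eq with refl ← label-injective eq = start family s

    Inf-mono : ∀ {t w} → Inf t w → Inf (suc t) w
    Inf-mono {t} p .informed f eq = step-mono family (informedAfter family s t) (informed p f eq)

    -- Adaptivity makes the history of `v` irrelevant: once everything ahead of `w` in its list is
    -- informed, its next call goes to `w`, unless `w` is informed already.
    Inf-call : ∀ {t v w} → Used v → Inf t v → First (Inf t) (_≡ w) (calls v) → Inf (suc t) w
    Inf-call {t} (f , refl) fInf first .informed g refl = reach (I g) refl
      where
      I = informedAfter family s t
      reach : ∀ b → I g ≡ b → informedAfter family s (suc t) g ≡ true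
      reach true  Ig = step-mono family I Ig
      reach false Ig = step-call family I If (begin
        firstUninformed I (lst family f)                        ≡⟨ firstUninformed-drop I If (deduplicate Fin._≟_ (callees f)) ⟩
        firstUninformed I (deduplicate Fin._≟_ (callees f))     ≡⟨ firstUninformed-deduplicate I (callees f) ⟩
        firstUninformed I (callees f)                           ≡⟨ firstUninformed-first I (first-callee (First.map₁ informed first)) Ig ⟩
        just g                                                  ∎)
        where
        open ≡-Reasoning
        If = informed fInf f refl

  -- Each edge is charged to an endpoint whose `out` list contains the other one. The count uses
  -- pairs ordered by vertex number, which need not agree with this orientation; recording both
  -- orders of a charged pair costs the factor 2.
  numEdges≤ : ∀ (out : W → List W) {c} → (∀ w → length (out w) ≤ c) →
              (∀ {f g} → label g ∈ calls (label f) → label g ∈ out (label f) ⊎ label f ∈ out (label g)) →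
              numEdges graph ≤ n * (c * 2)
  numEdges≤ out {c} out≤ cover = begin
    numEdges graph            ≤⟨ injection⇒length≤ labels labels-injective unique edge∈ ⟩
    length (concatMap incident (allFin n)) ≤⟨ length-concatMap≤ incident incident≤ (allFin n) ⟩
    length (allFin n) * (c * 2)  ≡⟨ cong (_* (c * 2)) (length-tabulate {n = n} id) ⟩
    n * (c * 2) ∎
    where
    open ≤-Reasoning
    pairs ordered : List (Fin n × Fin n)
    pairs = cartesianProduct (allFin n) (allFin n)
    ordered = filter (λ p → proj₁ p Fin.<? proj₂ p) pairs
    adjacent? = λ (p : Fin n × Fin n) → adj graph (proj₁ p) (proj₂ p) Bool.≟ true
    labels : Fin n × Fin n → W × W
    labels (f , g) = label f , label g
    labels-injective : ∀ {x y} → labels x ≡ labels y → x ≡ y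
    labels-injective eq = cong₂ _,_ (label-injective (cong proj₁ eq)) (label-injective (cong proj₂ eq))
    both : W → W → List (W × W)
    both v w = (v , w) ∷ (w , v) ∷ []
    incident : Fin n → List (W × W)
    incident f = concatMap (both (label f)) (out (label f))
    incident≤ : ∀ f → length (incident f) ≤ c * 2
    incident≤ f = ≤-trans (length-concatMap≤ (both (label f)) (λ _ → ≤-refl) (out (label f)))
                          (*-monoˡ-≤ 2 (out≤ (label f)))
    unique : Unique (filter adjacent? ordered)
    unique = Uniqueₚ.filter⁺ adjacent? (Uniqueₚ.filter⁺ (λ p → proj₁ p Fin.<? proj₂ p)
               (Uniqueₚ.cartesianProduct⁺ (Uniqueₚ.allFin⁺ n) (Uniqueₚ.allFin⁺ n)))
    member : ∀ f {p w} → w ∈ out (label f) → p ∈ both (label f) w → p ∈ concatMap incident (allFin n)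
    member f w∈ p∈ = ∈-concatMap⁺ incident (lose (∈-allFin f) (∈-concatMap⁺ (both (label f)) (lose w∈ p∈)))
    joined : ∀ {f g} → label g ∈ out (label f) ⊎ label f ∈ out (label g) →
             labels (f , g) ∈ concatMap incident (allFin n)
    joined {f} (inj₁ g∈) = member f g∈ (here refl)
    joined {g = g} (inj₂ f∈) = member g f∈ (there (here refl))
    edge∈ : ∀ {p} → p ∈ filter adjacent? ordered → labels p ∈ concatMap incident (allFin n)
    edge∈ {f , g} p∈ with _ , adjacent ← ∈-filter⁻ adjacent? {xs = ordered} p∈
      with toWitness {a? = linked? f g} (≡true⇒T (trans (isYes≗does (linked? f g)) adjacent))
    ... | _ , inj₁ g∈ = joined (cover g∈)
    ... | _ , inj₂ f∈ = joined (Sum.swap (cover f∈))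

-- Bit vectors, single-bit flips and counts of set positions.

bit : ∀ {d} → Vec Bool d → ℕ → Bool
bit []      _       = false
bit (b ∷ _) zero    = b
bit (_ ∷ v) (suc i) = bit v i

flip : ∀ {d} → ℕ → Vec Bool d → Vec Bool d
flip _       []      = []
flip zero    (b ∷ v) = not b ∷ v
flip (suc i) (b ∷ v) = b ∷ flip i v

zeros : ∀ {d} → Vec Bool d
zeros = Vec.replicate _ false

unit : ∀ {d} → ℕ → Vec Bool d
unit i = flip i zeros

_≟ᵛ_ : ∀ {d} → DecidableEquality (Vec Bool d)
_≟ᵛ_ = Vecₚ.≡-dec Bool._≟_

bit-ext : ∀ {d} (v w : Vec Bool d) → (∀ i → bit v i ≡ bit w i) → v ≡ w
bit-ext []      []      _  = refl
bit-ext (_ ∷ v) (_ ∷ w) eq = cong₂ _∷_ (eq 0) (bit-ext v w (eq ∘ suc))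

bit-zeros : ∀ {d} i → bit (zeros {d}) i ≡ false
bit-zeros {zero}  _       = refl
bit-zeros {suc d} zero    = refl
bit-zeros {suc d} (suc i) = bit-zeros {d} i

bit-true⇒< : ∀ {d} (v : Vec Bool d) {i} → bit v i ≡ true → i < d
bit-true⇒< (_ ∷ _) {zero}  _  = s≤s z≤n
bit-true⇒< (_ ∷ v) {suc i} eq = s≤s (bit-true⇒< v eq)

-- Inductions over dimensions constrain the positions from `j` on; since bits beyond the length read
-- `false`, at `j = d` the constraint holds for every vector.
bit-≥ : ∀ {d} (v : Vec Bool d) {i} → d ≤ i → bit v i ≡ false
bit-≥ []      _           = refl
bit-≥ (_ ∷ v) (s≤s d≤i) = bit-≥ v d≤i

bit-flip : ∀ {d} (v : Vec Bool d) {i} → i < d → bit (flip i v) i ≡ not (bit v i)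
bit-flip (_ ∷ _) {zero}  _         = refl
bit-flip (_ ∷ v) {suc i} (s≤s i<d) = bit-flip v i<d

bit-flip-≢ : ∀ {d} (v : Vec Bool d) {i j} → i ≢ j → bit (flip i v) j ≡ bit v j
bit-flip-≢ []      _                   = refl
bit-flip-≢ (_ ∷ _) {zero}  {zero}  i≢j = contradiction refl i≢j
bit-flip-≢ (_ ∷ _) {zero}  {suc _} _   = refl
bit-flip-≢ (_ ∷ _) {suc _} {zero}  _   = refl
bit-flip-≢ (_ ∷ v) {suc _} {suc _} i≢j = bit-flip-≢ v (i≢j ∘ cong suc)

flip-flip : ∀ {d} i (v : Vec Bool d) → flip i (flip i v) ≡ v
flip-flip _       []      = refl
flip-flip zero    (b ∷ v) = cong (_∷ v) (Boolₚ.not-involutive b)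
flip-flip (suc i) (b ∷ v) = cong (b ∷_) (flip-flip i v)

flip-set : ∀ {d} (v : Vec Bool d) {i} → bit v i ≡ true → bit (flip i v) i ≡ false
flip-set v eq = trans (bit-flip v (bit-true⇒< v eq)) (cong not eq)

flip-unset : ∀ {d} (v : Vec Bool d) {i} → i < d → bit v i ≡ false → bit (flip i v) i ≡ true
flip-unset v i<d eq = trans (bit-flip v i<d) (cong not eq)

set⇒≢zeros : ∀ {d} (v : Vec Bool d) {i} → bit v i ≡ true → v ≢ zeros
set⇒≢zeros {d} v {i} eq refl with () ← trans (sym eq) (bit-zeros {d} i)

bit-unit-≢ : ∀ {d i j} → i ≢ j → bit (unit {d} i) j ≡ false
bit-unit-≢ {d} {j = j} i≢j = trans (bit-flip-≢ (zeros {d}) i≢j) (bit-zeros {d} j)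

bit-unit⁻ : ∀ {d} i {j} → bit (unit {d} i) j ≡ true → i ≡ j
bit-unit⁻ {d} i {j} eq with i ≟ j
... | yes i≡j = i≡j
... | no i≢j with () ← trans (sym eq) (bit-unit-≢ {d} i≢j)

top-bit : ∀ {d} (v : Vec Bool d) → v ≢ zeros →
          ∃ λ z → bit v z ≡ true × (∀ {i} → z < i → bit v i ≡ false)
top-bit []      v≢0 = contradiction refl v≢0
top-bit (b ∷ v) v≢0 with v ≟ᵛ zeros
... | no v≢0′ with z , set , above ← top-bit v v≢0′ =
        suc z , set , λ { {suc i} (s≤s z<i) → above z<i }
top-bit {suc d} (true ∷ v) _ | yes refl = 0 , refl , λ { {suc i} _ → bit-zeros {d} i }
top-bit (false ∷ v) v≢0 | yes refl = contradiction refl v≢0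

count : (ℕ → Bool) → ℕ → ℕ
count β zero    = 0
count β (suc j) = if β j then suc (count β j) else count β j

count-complement : ∀ β j → count (not ∘ β) j + count β j ≡ j
count-complement β zero = refl
count-complement β (suc j) with β j
... | true  = trans (+-suc _ _) (cong suc (count-complement β j))
... | false = cong suc (count-complement β j)

count-constant : ∀ β {i j} → i ≤ j → (∀ {k} → i ≤ k → k < j → β k ≡ false) → count β j ≡ count β i
count-constant β {j = zero} z≤n _ = refl
count-constant β {i} {suc j} i≤1+j off with m≤n⇒m<n∨m≡n i≤1+j
... | inj₂ refl = refl
... | inj₁ (s≤s i≤j) rewrite off i≤j ≤-refl = count-constant β i≤j λ i≤k k<j → off i≤k (m≤n⇒m≤1+n k<j)

first-applyUpTo : ∀ {A : Set} {P Q : A → Set} (g : ℕ → A) {d m} → m < d → Q (g m) →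
                  (∀ {i} → i < m → P (g i)) → First P Q (applyUpTo g d)
first-applyUpTo g {suc d} {zero}  _         q before = [ q ]
first-applyUpTo g {suc d} {suc m} (s≤s m<d) q before =
  before (s≤s z≤n) ∷ first-applyUpTo (g ∘ suc) m<d q (before ∘ s≤s)

+2^-< : ∀ i {q} → q < 2 ^ i → q + 2 ^ i < 2 ^ suc i
+2^-< i {q} q<2^i = subst (q + 2 ^ i <_) (cong (2 ^ i +_) (sym (+-identityʳ (2 ^ i)))) (+-monoˡ-< (2 ^ i) q<2^i)

-- The punctured cube with binomial trees.

-- The core consists of the nonzero vectors, the cube without its zero vertex.
module CoreTree (d r : ℕ) where

  W : Set
  W = Vec Bool d × ℕ

  _≟ᵂ_ : DecidableEquality W
  _≟ᵂ_ = Productₚ.≡-dec _≟ᵛ_ _≟_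

  set? : ∀ (x : Vec Bool d) i → Dec (bit x i ≡ true)
  set? x i = bit x i Bool.≟ true

  unset? : ∀ (x : Vec Bool d) i → Dec (bit x i ≡ false)
  unset? x i = bit x i Bool.≟ false

  neighbour : Vec Bool d → ℕ → W
  neighbour x i = flip i x , 0

  hub : ℕ → W
  hub i = unit i , 0

  child : W → ℕ → W
  child (x , q) j = x , q + 2 ^ j

  coreCalls : W → List W
  coreCalls (x , zero)  = map (neighbour x) (filter (set? x) (upTo d)) ++
                          map (neighbour x) (filter (unset? x) (upTo d))
  coreCalls (x , suc _) = applyUpTo hub d

  calls : W → List W
  calls v = coreCalls v ++ map (child v) (filter (λ j → proj₂ v <? 2 ^ j) (upTo r))

  -- Node `q` of the binomial tree has the children `q + 2 ^ j` with `q < 2 ^ j`, so its parent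
  -- arises by removing the highest binary digit, sought here from position `j ∸ 1` downwards.
  parent : ℕ → ℕ → ℕ
  parent zero    _ = 0
  parent (suc j) q with 2 ^ j ≤? q
  ... | yes _ = q ∸ 2 ^ j
  ... | no _  = parent j q

  parent-child : ∀ {j i q} → i < j → q < 2 ^ i → parent j (q + 2 ^ i) ≡ q
  parent-child {suc j} {i} {q} (s≤s i≤j) q<2^i with 2 ^ j ≤? q + 2 ^ i | m≤n⇒m<n∨m≡n i≤j
  ... | yes _   | inj₂ refl = m+n∸n≡m q (2 ^ j)
  ... | no ≰    | inj₂ refl = contradiction (m≤n+m (2 ^ j) q) ≰
  ... | no _    | inj₁ i<j  = parent-child i<j q<2^i
  ... | yes big | inj₁ i<j  =
          contradiction (<-≤-trans (+2^-< i q<2^i) (≤-trans (^-monoʳ-≤ 2 i<j) big)) (<-irrefl refl)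

  -- Tree edges are charged to the child and hub edges to the end outside the core. This bounds the
  -- charge by `suc d`, whereas the degree of a hub can be large.
  links : W → List W
  links (x , zero)    = applyUpTo (neighbour x) d
  links (x , q@(suc _)) = (x , parent r q) ∷ applyUpTo hub d

  length-links : ∀ v → length (links v) ≤ suc d
  length-links (x , zero)  = m≤n⇒m≤1+n (≤-reflexive (length-applyUpTo (neighbour x) d))
  length-links (x , suc _) = s≤s (≤-reflexive (length-applyUpTo hub d))

  parent∈links : ∀ x {q} → 0 < q → (x , parent r q) ∈ links (x , q)
  parent∈links x {suc _} _ = here refl

  calls⊆links : ∀ v {w} → w ∈ calls v → w ∈ links v ⊎ v ∈ links w
  calls⊆links v@(x , q) w∈ with ∈-++⁻ (coreCalls v) w∈
  ... | inj₂ w∈children with j , j∈ , refl ← ∈-map⁻ (child v) w∈children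
    with j∈upTo , q<2^j ← ∈-filter⁻ (λ j → q <? 2 ^ j) {xs = upTo r} j∈ =
    inj₂ (subst (λ p → (x , p) ∈ links (x , q + 2 ^ j)) (parent-child (∈-upTo⁻ j∈upTo) q<2^j)
      (parent∈links x (≤-trans (m^n>0 2 j) (m≤n+m (2 ^ j) q))))
  calls⊆links v@(x , suc q) w∈ | inj₁ w∈hubs = inj₁ (there w∈hubs)
  calls⊆links v@(x , zero) w∈ | inj₁ w∈core with ∈-++⁻ (map (neighbour x) (filter (set? x) (upTo d))) w∈core
  ... | inj₁ w∈set with i , i∈ , refl ← ∈-map⁻ (neighbour x) w∈set =
    inj₁ (∈-applyUpTo⁺ (neighbour x) (∈-upTo⁻ (proj₁ (∈-filter⁻ (set? x) {xs = upTo d} i∈))))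
  ... | inj₂ w∈unset with i , i∈ , refl ← ∈-map⁻ (neighbour x) w∈unset =
    inj₁ (∈-applyUpTo⁺ (neighbour x) (∈-upTo⁻ (proj₁ (∈-filter⁻ (unset? x) {xs = upTo d} i∈))))

  module Scheme {n : ℕ} (label : Fin n → W) (label-injective : ∀ {f g} → label f ≡ label g → f ≡ g)
                (nonzero   : ∀ f → proj₁ (label f) ≢ zeros)
                (core-used : ∀ x → x ≢ zeros → ∃ λ f → label f ≡ (x , 0))
                (down      : ∀ f {x q p} → label f ≡ (x , q) → p < q → ∃ λ g → label g ≡ (x , p))
                (bounded   : ∀ f → proj₂ (label f) < 2 ^ r) where

    open LabelledNetwork _≟ᵂ_ label label-injective calls public

    module FromSource (s : Fin n) where

      open Broadcast s

      Inf₀ : ℕ → Vec Bool d → Set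
      Inf₀ t x = Inf t (x , 0)

      -- No vertex carries the zero vector, so it is skipped from the start; only the calls it would
      -- have placed need a substitute.
      Inf-zeros : ∀ {t} → Inf₀ t zeros
      Inf-zeros .informed f eq = contradiction (cong proj₁ eq) (nonzero f)

      call-set : ∀ {t x m} → Inf₀ t x → bit x m ≡ true →
                 (∀ {i} → i < m → bit x i ≡ true → Inf₀ t (flip i x)) → Inf₀ (suc t) (flip m x)
      call-set {t} {x} infₓ set before =
        Inf-call (core-used _ (set⇒≢zeros x set)) infₓ (First-++⁺ˡ (First-++⁺ˡ
          (First-upTo {P = Inf t} (set? x) (neighbour x) (bit-true⇒< x set) set refl before)))

      call-unset : ∀ {t x m} → x ≢ zeros → Inf₀ t x → m < d → bit x m ≡ false →
                   (∀ {i} → bit x i ≡ true → Inf₀ t (flip i x)) →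
                   (∀ {i} → i < m → bit x i ≡ false → Inf₀ t (flip i x)) → Inf₀ (suc t) (flip m x)
      call-unset {t} {x} x≢0 infₓ m<d unset beforeˢ beforeᵘ =
        Inf-call (core-used x x≢0) infₓ (First-++⁺ˡ (First-++⁺ʳ
          (All-upTo {P = Inf t} (set? x) (neighbour x) {d = d} (λ _ → beforeˢ))
          (First-upTo {P = Inf t} (unset? x) (neighbour x) m<d unset refl beforeᵘ)))

      -- A source outside the core plays the part of the missing zero vertex.
      module Outside {x q} (source : label s ≡ (x , suc q)) where

        -- One dimension per round: ahead of a new vertex `y`, the list of its caller `flip j y` has
        -- only neighbours within the first `j` dimensions, and these are informed.
        outside : ∀ j y → (∀ {i} → j ≤ i → bit y i ≡ false) → Inf₀ j y
        outside zero y low = subst (Inf₀ 0) (sym (bit-ext y zeros λ i → trans (low z≤n) (sym (bit-zeros {d} i)))) Inf-zeros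
        outside (suc j) y low with bit y j in yj
        ... | false = Inf-mono (outside j y low′)
          where
          low′ : ∀ {i} → j ≤ i → bit y i ≡ false
          low′ {i} j≤i with m≤n⇒m<n∨m≡n j≤i
          ... | inj₁ j<i  = low j<i
          ... | inj₂ refl = yj
        ... | true = subst (Inf₀ (suc j)) (flip-flip j y) fromParent
          where
          v = flip j y
          lowᵛ : ∀ {i} → j ≤ i → bit v i ≡ false
          lowᵛ {i} j≤i with m≤n⇒m<n∨m≡n j≤i
          ... | inj₁ j<i  = trans (bit-flip-≢ y (<⇒≢ j<i)) (low j<i)
          ... | inj₂ refl = flip-set y yj
          low-flip : ∀ {m i} → m < j → j ≤ i → bit (flip m v) i ≡ false
          low-flip m<j j≤i = trans (bit-flip-≢ v (<⇒≢ (<-≤-trans m<j j≤i))) (lowᵛ j≤i)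
          flipped : ∀ {m} → m < j → Inf₀ j (flip m v)
          flipped m<j = outside j _ (low-flip m<j)
          below : ∀ {m} → bit v m ≡ true → m < j
          below {m} set with m <? j
          ... | yes m<j = m<j
          ... | no m≮j with () ← trans (sym set) (lowᵛ (≮⇒≥ m≮j))
          fromParent : Inf₀ (suc j) (flip j v)
          fromParent with v ≟ᵛ zeros
          ... | no v≢0  = call-unset v≢0 (outside j v lowᵛ) (bit-true⇒< y yj) (flip-set y yj)
                            (λ set → flipped (below set)) (λ m<j _ → flipped m<j)
          -- Here `y` is a unit vector and its caller would be the zero vertex. The source calls it
          -- from its list of hubs, all smaller hubs being informed.
          ... | yes v≡0 = subst (λ w → Inf₀ (suc j) (flip j w)) (sym v≡0)
              (Inf-call (s , source) (Inf-keep j)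
                (First-++⁺ˡ (first-applyUpTo hub (bit-true⇒< y yj) refl
                  (λ {i} i<j → subst (λ w → Inf₀ j (flip i w)) v≡0 (flipped i<j)))))
            where
            Inf-keep : ∀ t → Inf t (x , suc q)
            Inf-keep zero    = subst (Inf 0) source Inf-source
            Inf-keep (suc t) = Inf-mono (Inf-keep t)

      -- A source x in the core first informs the subsets of x and then, in increasing order, adds the
      -- remaining dimensions.  The vertex unit z, which would have to inform the missing zero vertex
      -- in the last round of the first phase, is from then on one dimension ahead (second component
      -- of phase₂), which makes up for the calls the zero vertex would have placed.
      module Inside {x} (source : label s ≡ (x , 0)) where

        x≢0 : x ≢ zeros
        x≢0 = subst (_≢ zeros) (cong proj₁ source) (nonzero s)

        -- Only positions set in `x` take a round. A subset `y` of `x` that lacks such a `j` is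
        -- called by `flip j y`; ahead of this call are vectors with a lower set bit cleared, which
        -- the induction covers.
        phase₁ : ∀ j y → (∀ {i} → j ≤ i → bit y i ≡ bit x i) →
                 (∀ {i} → bit x i ≡ false → bit y i ≡ false) → Inf₀ (count (bit x) j) y
        phase₁ zero y agree _ = subst (Inf 0) (trans source (cong (_, 0) (bit-ext x y λ i → sym (agree z≤n)))) Inf-source
        phase₁ (suc j) y agree sub with bit x j in xj
        ... | false = phase₁ j y agree′ sub
          where
          agree′ : ∀ {i} → j ≤ i → bit y i ≡ bit x i
          agree′ j≤i with m≤n⇒m<n∨m≡n j≤i
          ... | inj₁ j<i  = agree j<i
          ... | inj₂ refl = trans (sub xj) (sym xj)
        ... | true with bit y j in yj
        ...   | true = Inf-mono (phase₁ j y agree′ sub)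
          where
          agree′ : ∀ {i} → j ≤ i → bit y i ≡ bit x i
          agree′ j≤i with m≤n⇒m<n∨m≡n j≤i
          ... | inj₁ j<i  = agree j<i
          ... | inj₂ refl = trans yj (sym xj)
        ...   | false = subst (Inf₀ _) (flip-flip j y)
                (call-set (phase₁ j v agreeᵛ subᵛ) vj λ i<j set → phase₁ j _ (agree-flip i<j) (sub-flip set))
          where
          v = flip j y
          vj : bit v j ≡ true
          vj = flip-unset y (bit-true⇒< x xj) yj
          agreeᵛ : ∀ {i} → j ≤ i → bit v i ≡ bit x i
          agreeᵛ j≤i with m≤n⇒m<n∨m≡n j≤i
          ... | inj₁ j<i  = trans (bit-flip-≢ y (<⇒≢ j<i)) (agree j<i)
          ... | inj₂ refl = trans vj (sym xj)
          subᵛ : ∀ {i} → bit x i ≡ false → bit v i ≡ false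
          subᵛ {i} xi with j ≟ i
          ... | yes refl with () ← trans (sym xj) xi
          ... | no j≢i = trans (bit-flip-≢ y j≢i) (sub xi)
          agree-flip : ∀ {m i} → m < j → j ≤ i → bit (flip m v) i ≡ bit x i
          agree-flip m<j j≤i = trans (bit-flip-≢ v (<⇒≢ (<-≤-trans m<j j≤i))) (agreeᵛ j≤i)
          sub-flip : ∀ {m i} → bit v m ≡ true → bit x i ≡ false → bit (flip m v) i ≡ false
          sub-flip {m} {i} set xi with m ≟ i
          ... | yes refl = flip-set v set
          ... | no m≢i = trans (bit-flip-≢ v m≢i) (subᵛ xi)

        z : ℕ
        z = proj₁ (top-bit x x≢0)

        xz : bit x z ≡ true
        xz = proj₁ (proj₂ (top-bit x x≢0))

        above-z : ∀ {i} → z < i → bit x i ≡ false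
        above-z = proj₂ (proj₂ (top-bit x x≢0))

        z<d : z < d
        z<d = bit-true⇒< x xz

        e : Vec Bool d
        e = unit z

        ez : bit e z ≡ true
        ez = flip-unset (zeros {d}) z<d (bit-zeros {d} z)

        e-off : ∀ {i} → z ≢ i → bit e i ≡ false
        e-off = bit-unit-≢ {d}

        flip-e-off : ∀ {m i} → m ≢ i → z ≢ i → bit (flip m e) i ≡ false
        flip-e-off m≢i z≢i = trans (bit-flip-≢ e m≢i) (e-off z≢i)

        e≢0 : e ≢ zeros
        e≢0 = set⇒≢zeros e ez

        flip-z-e : ∀ {t i} → bit e i ≡ true → Inf₀ t (flip i e)
        flip-z-e {t} {i} set with refl ← bit-unit⁻ {d} z {i} set = subst (Inf₀ t) (sym (flip-flip z zeros)) Inf-zeros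

        ≢-by-bit : ∀ {i j} → bit x i ≡ true → bit x j ≡ false → i ≢ j
        ≢-by-bit xi xj refl with () ← trans (sym xi) xj

        count-z : count (bit x) d ≡ suc (count (bit x) z)
        count-z = trans (count-constant (bit x) z<d λ z<k _ → above-z z<k)
                        (cong (λ b → if b then suc (count (bit x) z) else count (bit x) z) xz)

        -- The first phase lasts `suc (count (bit x) z)` rounds, as `z` is its last dimension;
        -- afterwards each unset position takes one round.
        time : ℕ → ℕ
        time j = count (not ∘ bit x) j + suc (count (bit x) z)

        -- The first dimension that the second phase still has to add once the positions below `j`
        -- are done.
        Next : ℕ → ℕ → Set
        Next j c = j ≤ c × c < d × bit x c ≡ false × (∀ {i} → j ≤ i → i < c → bit x i ≡ true)

        flip-e-before-z : ∀ {i} → bit x i ≡ true → z ≢ i → Inf₀ (count (bit x) z) (flip i e)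
        flip-e-before-z {m} xm z≢m = phase₁ z (flip m e) agree λ xi → flip-e-off (≢-by-bit xm xi) (≢-by-bit xz xi)
          where
          agree : ∀ {i} → z ≤ i → bit (flip m e) i ≡ bit x i
          agree z≤i with m≤n⇒m<n∨m≡n z≤i
          ... | inj₁ z<i  = trans (flip-e-off (≢-by-bit xm (above-z z<i)) (<⇒≢ z<i)) (sym (above-z z<i))
          ... | inj₂ refl = trans (trans (bit-flip-≢ e (z≢m ∘ sym)) ez) (sym xz)

        e-before-z : Inf₀ (count (bit x) z) e
        e-before-z = phase₁ z e agree λ xi → e-off (≢-by-bit xz xi)
          where
          agree : ∀ {i} → z ≤ i → bit e i ≡ bit x i
          agree z≤i with m≤n⇒m<n∨m≡n z≤i
          ... | inj₁ z<i  = trans (e-off (<⇒≢ z<i)) (sym (above-z z<i))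
          ... | inj₂ refl = trans ez (sym xz)

        z≢ : ∀ {i} → bit e i ≡ false → z ≢ i
        z≢ off refl with () ← trans (sym ez) off

        phase₂ : ∀ j → (∀ y → (∀ {i} → j ≤ i → bit x i ≡ false → bit y i ≡ false) → Inf₀ (time j) y)
                     × (∀ c → Next j c → Inf₀ (time j) (flip c e))
        phase₂ zero =
          (λ y sub → subst (λ t → Inf₀ t y) count-z
            (phase₁ d y (λ d≤i → trans (bit-≥ y d≤i) (sym (bit-≥ x d≤i))) (sub z≤n))) ,
          -- `e` is informed by the round before the first phase ends, and its only set bit leads to
          -- the zero vertex. It skips that call and moves on to the first unset dimension, because
          -- `phase₁` has already informed `flip i e` for every other `i` set in `x`.
          λ c (_ , c<d , xc , between) → call-unset e≢0 e-before-z c<d (e-off (≢-by-bit xz xc)) flip-z-e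
            λ i<c off → flip-e-before-z (between z≤n i<c) (z≢ off)
        phase₂ (suc j) with bit x j in xj
        ... | true = (λ y sub → proj₁ (phase₂ j) y (sub′ y sub)) ,
                     λ c (j<c , c<d , xc , between) →
                       proj₂ (phase₂ j) c (<⇒≤ j<c , c<d , xc , between′ between)
          where
          sub′ : ∀ y → (∀ {i} → j < i → bit x i ≡ false → bit y i ≡ false) →
                 ∀ {i} → j ≤ i → bit x i ≡ false → bit y i ≡ false
          sub′ y sub j≤i xi = sub (≤∧≢⇒< j≤i (≢-by-bit xj xi)) xi
          between′ : ∀ {c} → (∀ {i} → j < i → i < c → bit x i ≡ true) → ∀ {i} → j ≤ i → i < c → bit x i ≡ true
          between′ between j≤i i<c with m≤n⇒m<n∨m≡n j≤i
          ... | inj₁ j<i  = between j<i i<c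
          ... | inj₂ refl = xj
        ... | false = full , ahead
          where
          fullʲ  = proj₁ (phase₂ j)
          aheadʲ = proj₂ (phase₂ j)
          e-full : Inf₀ (time j) e
          e-full = fullʲ e λ _ xi → e-off (≢-by-bit xz xi)
          next-j : j < d → Next j j
          next-j j<d = ≤-refl , j<d , xj , λ j≤i i<j → contradiction (≤-<-trans j≤i i<j) (<-irrefl refl)
          full : ∀ y → (∀ {i} → j < i → bit x i ≡ false → bit y i ≡ false) → Inf₀ (suc (time j)) y
          full y sub with bit y j in yj
          ... | false = Inf-mono (fullʲ y sub′)
            where
            sub′ : ∀ {i} → j ≤ i → bit x i ≡ false → bit y i ≡ false
            sub′ j≤i xi with m≤n⇒m<n∨m≡n j≤i
            ... | inj₁ j<i  = sub j<i xi
            ... | inj₂ refl = yj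
          ... | true = subst (Inf₀ _) (flip-flip j y) fromParent
            where
            j<d = bit-true⇒< y yj
            v = flip j y
            subᵛ : ∀ {i} → j ≤ i → bit x i ≡ false → bit v i ≡ false
            subᵛ j≤i xi with m≤n⇒m<n∨m≡n j≤i
            ... | inj₁ j<i  = trans (bit-flip-≢ y (<⇒≢ j<i)) (sub j<i xi)
            ... | inj₂ refl = flip-set y yj
            sub-set : ∀ {m i} → bit v m ≡ true → j ≤ i → bit x i ≡ false → bit (flip m v) i ≡ false
            sub-set {m} {i} set j≤i xi with m ≟ i
            ... | yes refl = flip-set v set
            ... | no m≢i = trans (bit-flip-≢ v m≢i) (subᵛ j≤i xi)
            sub-below : ∀ {m i} → m < j → j ≤ i → bit x i ≡ false → bit (flip m v) i ≡ false
            sub-below m<j j≤i xi = trans (bit-flip-≢ v (<⇒≢ (<-≤-trans m<j j≤i))) (subᵛ j≤i xi)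
            z≢j : z ≢ j
            z≢j = ≢-by-bit xz xj
            e′ = flip j e
            e′z : bit e′ z ≡ true
            e′z = trans (bit-flip-≢ e (z≢j ∘ sym)) ez
            flip-e′ : flip z e′ ≡ unit {d} j
            flip-e′ = bit-ext _ _ agree
              where
              agree : ∀ i → bit (flip z e′) i ≡ bit (unit {d} j) i
              agree i with z ≟ i | j ≟ i
              ... | yes refl | _ = trans (flip-set e′ e′z) (sym (bit-unit-≢ {d} (z≢j ∘ sym)))
              ... | no _ | yes refl = trans (bit-flip-≢ e′ z≢j)
                  (trans (flip-unset e j<d (e-off z≢j)) (sym (flip-unset (zeros {d}) j<d (bit-zeros {d} j))))
              ... | no z≢i | no j≢i = trans (bit-flip-≢ e′ z≢i) (trans (flip-e-off j≢i z≢i) (sym (bit-unit-≢ {d} j≢i)))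
            -- If `j < z`, then clearing bit `j` comes first in the list of `e′`; that call would go
            -- to `e`, which is informed.
            before-z : ∀ {i} → i < z → bit e′ i ≡ true → Inf₀ (time j) (flip i e′)
            before-z {i} i<z set with j ≟ i
            ... | yes refl = subst (Inf₀ (time j)) (sym (flip-flip j e)) e-full
            ... | no j≢i with () ← trans (sym set) (flip-e-off j≢i (<⇒≢ i<z ∘ sym))
            fromParent : Inf₀ (suc (time j)) (flip j v)
            fromParent with v ≟ᵛ zeros
            ... | no v≢0 = call-unset v≢0 (fullʲ v subᵛ) j<d (flip-set y yj)
                             (λ set → fullʲ _ (sub-set set)) (λ m<j _ → fullʲ _ (sub-below m<j))
            -- Here `y` is `unit j`, whose caller would be the zero vertex. Instead `e′`, informed
            -- one round early, clears bit `z` and calls it.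
            ... | yes v≡0 = subst (Inf₀ _) (trans flip-e′ (cong (flip j) (sym v≡0)))
                              (call-set (aheadʲ j (next-j j<d)) e′z before-z)
          ahead : ∀ c → Next (suc j) c → Inf₀ (suc (time j)) (flip c e)
          ahead c (j<c , c<d , xc , between) =
            call-unset e≢0 e-full c<d (e-off (≢-by-bit xz xc)) flip-z-e before
            where
            before : ∀ {i} → i < c → bit e i ≡ false → Inf₀ (time j) (flip i e)
            -- In the list of `e` ahead of `c`: the vertex for `j` was informed a round early,
            -- dimensions below `j` are done, and those between `j` and `c` are set in `x`.
            before {m} m<c off with <-cmp m j
            ... | tri≈ _ refl _ = aheadʲ m (next-j (<-trans m<c c<d))
            ... | tri< m<j _ _ = fullʲ _ λ j≤i xi → flip-e-off (<⇒≢ (<-≤-trans m<j j≤i)) (≢-by-bit xz xi)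
            ... | tri> _ _ j<m = fullʲ _ λ _ xi → flip-e-off (≢-by-bit (between j<m m<c) xi) (≢-by-bit xz xi)

        inside : ∀ y → Inf₀ d y
        inside y = subst (λ t → Inf₀ t y) all-rounds
                     (proj₁ (phase₂ d) y λ d≤i _ → bit-≥ y d≤i)
          where
          all-rounds : time d ≡ d
          -- Set and unset positions together make up the `d` dimensions, so the missing vertex
          -- costs no round.
          all-rounds = trans (cong (count (not ∘ bit x) d +_) (sym count-z)) (count-complement (bit x) d)

      core-informed : ∀ y → Inf₀ d y
      core-informed y = bySource (label s) refl
        where
        bySource : ∀ v → label s ≡ v → Inf₀ d y
        bySource (x , zero)  source = Inside.inside source y
        bySource (x , suc q) source = Outside.outside source d y (bit-≥ y)

      -- Binomial broadcast: the nodes from `2 ^ j` up to `2 ^ suc j` are called by the nodes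
      -- `2 ^ j` lower, whose earlier children all lie below `2 ^ j`.
      tree-informed : ∀ j → j ≤ r → ∀ {y q} → q < 2 ^ j → Inf (j + d) (y , q)
      tree-informed zero _ {y} {zero} _ = core-informed y
      tree-informed zero _ {y} {suc q} (s≤s ())
      tree-informed (suc j) j<r {y} {q} q<2^1+j with q <? 2 ^ j
      ... | yes q<2^j = Inf-mono (tree-informed j (<⇒≤ j<r) q<2^j)
      -- The trees may be truncated. Only a label carried by some vertex needs an argument, and then
      -- `down` provides the vertex of its parent.
      ... | no q≮2^j = inf λ f eq → informed
              (subst (λ p → Inf (suc (j + d)) (y , p)) p+2^j≡q
                (Inf-call (down f eq p<q) (level-j p<2^j)
                  (First-++⁺ʳ core (First-upTo {P = Inf (j + d)} (λ i → p <? 2 ^ i) (child (y , p)) j<r p<2^j refl earlier)))) f eq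
        where
        p = q ∸ 2 ^ j
        level-j : ∀ {y q} → q < 2 ^ j → Inf (j + d) (y , q)
        level-j = tree-informed j (<⇒≤ j<r)
        p+2^j≡q : p + 2 ^ j ≡ q
        p+2^j≡q = m∸n+n≡m (≮⇒≥ q≮2^j)
        p<2^j : p < 2 ^ j
        p<2^j = +-cancelʳ-< (2 ^ j) p (2 ^ j)
          (subst₂ _<_ (sym p+2^j≡q) (cong (2 ^ j +_) (+-identityʳ (2 ^ j))) q<2^1+j)
        p<q : p < q
        p<q = <-≤-trans p<2^j (≮⇒≥ q≮2^j)
        earlier : ∀ {i} → i < j → p < 2 ^ i → Inf (j + d) (y , p + 2 ^ i)
        earlier {i} i<j p<2^i = level-j (<-≤-trans (+2^-< i p<2^i) (^-monoʳ-≤ 2 i<j))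
        -- The core is complete after `d` rounds, so the core part of every list is skipped and the
        -- vertex turns to its children.
        core : All (Inf (j + d)) (coreCalls (y , p))
        core = All.tabulate (λ {w} w∈ → subst (Inf (j + d)) (cong (_ ,_) (sym (level-0 p w∈))) (level-j (m^n>0 2 j)))
          where
          level-0 : ∀ p {w} → w ∈ coreCalls (y , p) → proj₂ w ≡ 0
          level-0 zero w∈ with ∈-++⁻ (map (neighbour y) (filter (set? y) (upTo d))) w∈
          ... | inj₁ w∈ with _ , _ , refl ← ∈-map⁻ (neighbour y) w∈ = refl
          ... | inj₂ w∈ with _ , _ , refl ← ∈-map⁻ (neighbour y) w∈ = refl
          level-0 (suc p) w∈ with _ , _ , refl ← ∈-applyUpTo⁻ hub w∈ = refl

    completes : ∀ s → CompletesBy family s (r + d)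
    completes s f = Broadcast.informed (FromSource.tree-informed s r ≤-refl (bounded f)) f refl

    edges : numEdges graph ≤ n * (suc d * 2)
    edges = numEdges≤ links length-links (λ {f} → calls⊆links (label f))

-- The hypercube, for powers of two.

module Cube (d : ℕ) {n : ℕ} (label : Fin n → Vec Bool d)
            (label-injective : ∀ {f g} → label f ≡ label g → f ≡ g)
            (used : ∀ x → ∃ λ f → label f ≡ x) where

  calls : Vec Bool d → List (Vec Bool d)
  calls x = applyUpTo (λ i → flip i x) d

  open LabelledNetwork _≟ᵛ_ label label-injective calls public

  module FromSource (s : Fin n) where

    open Broadcast s

    -- Dimension `j` is used in round `suc j`: the neighbours of `flip j y` in lower dimensions
    -- agree with the source from `j` on and are informed already.
    subcube : ∀ j y → (∀ {i} → j ≤ i → bit y i ≡ bit (label s) i) → Inf j y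
    subcube zero y agree = subst (Inf 0) (bit-ext (label s) y λ i → sym (agree z≤n)) Inf-source
    subcube (suc j) y agree with bit y j Bool.≟ bit (label s) j
    ... | yes same = Inf-mono (subcube j y agree′)
      where
      agree′ : ∀ {i} → j ≤ i → bit y i ≡ bit (label s) i
      agree′ j≤i with m≤n⇒m<n∨m≡n j≤i
      ... | inj₁ j<i  = agree j<i
      ... | inj₂ refl = same
    ... | no different = subst (Inf (suc j)) (flip-flip j y)
            (Inf-call (used v) (subcube j v agreeᵛ)
              (first-applyUpTo (λ i → flip i v) j<d refl λ i<j → subcube j _ (agree-flip i<j)))
      where
      v = flip j y
      j<d : j < d
      j<d with j <? d
      ... | yes j<d = j<d
      ... | no j≮d = contradiction (trans (bit-≥ y (≮⇒≥ j≮d)) (sym (bit-≥ (label s) (≮⇒≥ j≮d)))) different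
      agreeᵛ : ∀ {i} → j ≤ i → bit v i ≡ bit (label s) i
      agreeᵛ j≤i with m≤n⇒m<n∨m≡n j≤i
      ... | inj₁ j<i  = trans (bit-flip-≢ y (<⇒≢ j<i)) (agree j<i)
      ... | inj₂ refl = trans (bit-flip y j<d) (sym (Boolₚ.¬-not (different ∘ sym)))
      agree-flip : ∀ {m i} → m < j → j ≤ i → bit (flip m v) i ≡ bit (label s) i
      agree-flip m<j j≤i = trans (bit-flip-≢ v (<⇒≢ (<-≤-trans m<j j≤i))) (agreeᵛ j≤i)

  completes : ∀ s → CompletesBy family s d
  completes s f = Broadcast.informed
    (FromSource.subcube s d (label f) λ d≤i → trans (bit-≥ (label f) d≤i) (sym (bit-≥ (label s) d≤i))) f refl

  edges : numEdges graph ≤ n * (d * 2)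
  edges = numEdges≤ calls (λ x → ≤-reflexive (length-applyUpTo (λ i → flip i x) d)) inj₁

-- Bit vectors as binary numbers, least significant digit first.

digit : Bool → ℕ
digit b = if b then 1 else 0

digit-odd : ∀ m → digit (m % 2 ≡ᵇ 1) ≡ m % 2
digit-odd m with m % 2 | m%n<n m 2
... | 0 | _ = refl
... | 1 | _ = refl
... | suc (suc _) | s≤s (s≤s ())

value : ∀ {d} → Vec Bool d → ℕ
value []      = 0
value (b ∷ v) = digit b + value v * 2

bits : ∀ d → ℕ → Vec Bool d
bits zero    _ = []
bits (suc d) m = (m % 2 ≡ᵇ 1) ∷ bits d (m / 2)

value-bits : ∀ d {m} → m < 2 ^ d → value (bits d m) ≡ m
value-bits zero    {zero} _ = refl
value-bits zero    {suc m} (s≤s ())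
value-bits (suc d) {m} m<2^1+d = begin
  digit (m % 2 ≡ᵇ 1) + value (bits d (m / 2)) * 2 ≡⟨ cong₂ (λ a b → a + b * 2) (digit-odd m) (value-bits d m/2<2^d) ⟩
  m % 2 + (m / 2) * 2                             ≡⟨ m≡m%n+[m/n]*n m 2 ⟨
  m                                               ∎
  where
  open ≡-Reasoning
  m/2<2^d : m / 2 < 2 ^ d
  m/2<2^d = m<n*o⇒m/o<n {n = 2 ^ d} (subst (m <_) (*-comm 2 (2 ^ d)) m<2^1+d)

bits-value : ∀ {d} (v : Vec Bool d) → bits d (value v) ≡ v
bits-value []      = refl
bits-value {suc d} (b ∷ v) = cong₂ _∷_
  (trans (cong (_≡ᵇ 1) ([m+kn]%n≡m%n (digit b) (value v) 2)) (digit-parity b))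
  (trans (cong (bits d) half) (bits-value v))
  where
  digit-parity : ∀ b → (digit b % 2 ≡ᵇ 1) ≡ b
  digit-parity true  = refl
  digit-parity false = refl
  digit-half : ∀ b → digit b / 2 ≡ 0
  digit-half true  = refl
  digit-half false = refl
  half : (digit b + value v * 2) / 2 ≡ value v
  half = trans (+-distrib-/-∣ʳ (digit b) (divides-refl (value v)))
               (cong₂ _+_ (digit-half b) (m*n/n≡m (value v) 2))

value<2^ : ∀ {d} (v : Vec Bool d) → value v < 2 ^ d
value<2^ [] = s≤s z≤n
value<2^ {suc d} (b ∷ v) = begin-strict
  digit b + value v * 2  <⟨ +-monoˡ-< (value v * 2) (digit<2 b) ⟩
  suc (value v) * 2      ≤⟨ *-monoˡ-≤ 2 (value<2^ v) ⟩
  2 ^ d * 2              ≡⟨ *-comm (2 ^ d) 2 ⟩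
  2 ^ suc d              ∎
  where
  open ≤-Reasoning
  digit<2 : ∀ b → digit b < 2
  digit<2 true  = s≤s (s≤s z≤n)
  digit<2 false = s≤s z≤n

value-zeros : ∀ d → value (zeros {d}) ≡ 0
value-zeros zero    = refl
value-zeros (suc d) = cong (_* 2) (value-zeros d)

value≡0⇒zeros : ∀ {d} (v : Vec Bool d) → value v ≡ 0 → v ≡ zeros
value≡0⇒zeros {d} v eq = begin
  v                        ≡⟨ bits-value v ⟨
  bits d (value v)         ≡⟨ cong (bits d) (trans eq (sym (value-zeros d))) ⟩
  bits d (value (zeros {d})) ≡⟨ bits-value zeros ⟩
  zeros                    ∎
  where open ≡-Reasoning

bits-injective : ∀ d {a b} → a < 2 ^ d → b < 2 ^ d → bits d a ≡ bits d b → a ≡ b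
bits-injective d a< b< eq = trans (sym (value-bits d a<)) (trans (cong value eq) (value-bits d b<))

-- Distributing `n` vertices over the core and its trees.

module CoreTreeLabels (d r M n : ℕ) .{{_ : NonZero M}} (1+M≡2^d : suc M ≡ 2 ^ d)
                      (M≤n : M ≤ n) (n≤M2^r : n ≤ M * 2 ^ r) where

  -- The successor of the residue runs through the nonzero vectors, and the quotient is the tree
  -- node. Filling one node of all trees before the next gives `core-used` and `down`.
  at : ℕ → Vec Bool d × ℕ
  at m = bits d (suc (m % M)) , m / M

  label : Fin n → Vec Bool d × ℕ
  label f = at (toℕ f)

  rem<2^d : ∀ m → suc (m % M) < 2 ^ d
  rem<2^d m = subst (suc (m % M) <_) 1+M≡2^d (s≤s (m%n<n m M))

  label-injective : ∀ {f g} → label f ≡ label g → f ≡ g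
  label-injective {f} {g} eq = toℕ-injective (begin
    toℕ f                             ≡⟨ m≡m%n+[m/n]*n (toℕ f) M ⟩
    toℕ f % M + (toℕ f / M) * M       ≡⟨ cong₂ (λ a b → a + b * M) same-rem (cong proj₂ eq) ⟩
    toℕ g % M + (toℕ g / M) * M       ≡⟨ m≡m%n+[m/n]*n (toℕ g) M ⟨
    toℕ g                             ∎)
    where
    open ≡-Reasoning
    same-rem : toℕ f % M ≡ toℕ g % M
    same-rem = suc-injective (bits-injective d (rem<2^d (toℕ f)) (rem<2^d (toℕ g)) (cong proj₁ eq))

  nonzero : ∀ f → proj₁ (label f) ≢ zeros
  nonzero f eq with () ← trans (sym (value-bits d (rem<2^d (toℕ f)))) (trans (cong value eq) (value-zeros d))

  at-+* : ∀ {a} q → a < M → at (a + q * M) ≡ (bits d (suc a) , q)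
  at-+* {a} q a<M = cong₂ _,_
    (cong (bits d ∘ suc) (trans ([m+kn]%n≡m%n a q M) (m<n⇒m%n≡m a<M)))
    (trans (+-distrib-/-∣ʳ a (divides-refl q)) (cong₂ _+_ (m<n⇒m/n≡0 a<M) (m*n/n≡m q M)))

  used : ∀ {a} q → a < M → a + q * M < n → ∃ λ f → label f ≡ (bits d (suc a) , q)
  used q a<M bound = fromℕ< bound , trans (cong at (toℕ-fromℕ< bound)) (at-+* q a<M)

  core-used : ∀ x → x ≢ zeros → ∃ λ f → label f ≡ (x , 0)
  core-used x x≢0 = byValue (value x) refl
    where
    byValue : ∀ m → value x ≡ m → ∃ λ f → label f ≡ (x , 0)
    byValue zero    eq = contradiction (value≡0⇒zeros x eq) x≢0
    byValue (suc a) eq =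
      let f , lf = used 0 a<M (<-≤-trans (subst (_< M) (sym (+-identityʳ a)) a<M) M≤n)
      in f , trans lf (cong (_, 0) (trans (cong (bits d) (sym eq)) (bits-value x)))
      where
      a<M : a < M
      a<M = s≤s⁻¹ (subst₂ _<_ eq (sym 1+M≡2^d) (value<2^ x))

  down : ∀ f {x q p} → label f ≡ (x , q) → p < q → ∃ λ g → label g ≡ (x , p)
  down f {p = p} refl p<q = used p (m%n<n (toℕ f) M) (begin-strict
    toℕ f % M + p * M           <⟨ +-monoʳ-< (toℕ f % M) (*-monoˡ-< M p<q) ⟩
    toℕ f % M + (toℕ f / M) * M ≡⟨ m≡m%n+[m/n]*n (toℕ f) M ⟨
    toℕ f                       <⟨ toℕ<n f ⟩
    n                           ∎)
    where open ≤-Reasoning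

  bounded : ∀ f → proj₂ (label f) < 2 ^ r
  bounded f = m<n*o⇒m/o<n {n = 2 ^ r} (<-≤-trans (toℕ<n f) (subst (n ≤_) (*-comm M (2 ^ r)) n≤M2^r))

  open CoreTree d r using (module Scheme)
  open Scheme label label-injective nonzero core-used down bounded public using (graph; family; completes; edges)

-- Leading ones and the size of the number.

valueᴹ : List Bool → ℕ
valueᴹ []       = 0
valueᴹ (b ∷ bs) = digit b * 2 ^ length bs + valueᴹ bs

valueᴹ-∷ʳ : ∀ bs b → valueᴹ (bs ∷ʳ b) ≡ digit b + valueᴹ bs * 2
valueᴹ-∷ʳ [] b = cong (_+ 0) (*-identityʳ (digit b))
valueᴹ-∷ʳ (a ∷ bs) b = begin
  digit a * 2 ^ length (bs ∷ʳ b) + valueᴹ (bs ∷ʳ b)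
    ≡⟨ cong₂ (λ l v → digit a * 2 ^ l + v) (trans (length-++ bs) (+-comm (length bs) 1)) (valueᴹ-∷ʳ bs b) ⟩
  digit a * (2 * 2 ^ length bs) + (digit b + valueᴹ bs * 2)
    ≡⟨ solve 4 (λ x y z w → x :* (con 2 :* y) :+ (z :+ w :* con 2) := z :+ (x :* y :+ w) :* con 2) refl
         (digit a) (2 ^ length bs) (digit b) (valueᴹ bs) ⟩
  digit b + (digit a * 2 ^ length bs + valueᴹ bs) * 2 ∎
  where
  open ≡-Reasoning
  open +-*-Solver

value-bitsLSB : ∀ f m → m ≤ f → valueᴹ (reverse (bitsLSB f m)) ≡ m
value-bitsLSB zero    zero    _ = refl
value-bitsLSB (suc f) zero    _ = refl
value-bitsLSB (suc f) (suc m) (s≤s m≤f) = begin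
  valueᴹ (reverse (b ∷ bs))                      ≡⟨ cong valueᴹ (unfold-reverse b bs) ⟩
  valueᴹ (reverse bs ∷ʳ b)                       ≡⟨ valueᴹ-∷ʳ (reverse bs) b ⟩
  digit b + valueᴹ (reverse bs) * 2              ≡⟨ cong₂ (λ x y → x + y * 2) (digit-odd (suc m)) (value-bitsLSB f (suc m / 2) half≤f) ⟩
  suc m % 2 + (suc m / 2) * 2                    ≡⟨ m≡m%n+[m/n]*n (suc m) 2 ⟨
  suc m                                          ∎
  where
  open ≡-Reasoning
  b  = suc m % 2 ≡ᵇ 1
  bs = bitsLSB f (suc m / 2)
  half≤f : suc m / 2 ≤ f
  half≤f = ≤-trans (s≤s⁻¹ (m/n<m (suc m) 2 ≤-refl)) m≤f

leadingOnes-∷ʳ : ∀ bs b → leadingOnes bs ≤ leadingOnes (bs ∷ʳ b)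
leadingOnes-∷ʳ []           b = z≤n
leadingOnes-∷ʳ (true ∷ bs)  b = s≤s (leadingOnes-∷ʳ bs b)
leadingOnes-∷ʳ (false ∷ bs) b = z≤n

-- Supplies `1 ≤ L`: the leading digit of a number above one is that of its half, which stays
-- positive.
leadingOnes-bitsLSB : ∀ f m → suc m ≤ f → 1 ≤ leadingOnes (reverse (bitsLSB f (suc m)))
leadingOnes-bitsLSB (suc zero)    zero _ = ≤-refl
leadingOnes-bitsLSB (suc (suc f)) zero _ = ≤-refl
leadingOnes-bitsLSB (suc f) (suc m) (s≤s 1+m≤f) =
  subst (λ bs → 1 ≤ leadingOnes bs) (sym (unfold-reverse b (bitsLSB f half)))
    (≤-trans (higher half positive half≤f) (leadingOnes-∷ʳ (reverse (bitsLSB f half)) b))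
  where
  b = suc (suc m) % 2 ≡ᵇ 1
  half = suc (suc m) / 2
  positive : 0 < half
  positive = m≥n⇒m/n>0 {suc (suc m)} {2} (s≤s (s≤s z≤n))
  half≤f : half ≤ f
  half≤f = ≤-trans (s≤s⁻¹ (m/n<m (suc (suc m)) 2 ≤-refl)) 1+m≤f
  higher : ∀ k → 0 < k → k ≤ f → 1 ≤ leadingOnes (reverse (bitsLSB f k))
  higher (suc k) _ k≤f = leadingOnes-bitsLSB f k k≤f

valueᴹ<2^ : ∀ bs → valueᴹ bs < 2 ^ length bs
valueᴹ<2^ [] = s≤s z≤n
valueᴹ<2^ (b ∷ bs) = begin-strict
  digit b * 2 ^ length bs + valueᴹ bs <⟨ +-mono-≤-< (*-monoˡ-≤ (2 ^ length bs) (digit≤1 b)) (valueᴹ<2^ bs) ⟩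
  1 * 2 ^ length bs + 2 ^ length bs   ≡⟨ +-comm (1 * 2 ^ length bs) (2 ^ length bs) ⟩
  2 ^ suc (length bs)                 ∎
  where
  open ≤-Reasoning
  digit≤1 : ∀ b → digit b ≤ 1
  digit≤1 true  = ≤-refl
  digit≤1 false = z≤n

-- Unless all digits are ones, `L` ones are followed by a zero and `r` further digits, so the value
-- is `2 ^ (suc L + r) ∸ 2 ^ suc r` plus a number below `2 ^ r`. The bounds are stated additively to
-- avoid truncated subtraction.
leadingOnes-split : ∀ bs → let L = leadingOnes bs in
  (length bs ≡ L × suc (valueᴹ bs) ≡ 2 ^ L) ⊎
  (∃ λ r → length bs ≡ suc L + r × suc (valueᴹ bs) + 2 ^ r ≤ 2 ^ (suc L + r)
         × 2 ^ (suc L + r) < suc (valueᴹ bs) + 2 ^ suc r)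
leadingOnes-split [] = inj₁ (refl , refl)
leadingOnes-split (false ∷ bs) = inj₂ (length bs , refl ,
  subst (suc (valueᴹ bs) + 2 ^ length bs ≤_) (cong (2 ^ length bs +_) (sym (+-identityʳ (2 ^ length bs))))
    (+-monoˡ-≤ (2 ^ length bs) (valueᴹ<2^ bs)) ,
  s≤s (m≤n+m (2 ^ suc (length bs)) (valueᴹ bs)))
leadingOnes-split (true ∷ bs) with leadingOnes-split bs
... | inj₁ (len , val) = inj₁ (cong suc len , (begin
    suc (1 * 2 ^ length bs + valueᴹ bs) ≡⟨ +-suc (1 * 2 ^ length bs) (valueᴹ bs) ⟨
    1 * 2 ^ length bs + suc (valueᴹ bs) ≡⟨ cong₂ (λ l v → 1 * 2 ^ l + v) len val ⟩
    1 * 2 ^ L + 2 ^ L                   ≡⟨ +-comm (1 * 2 ^ L) (2 ^ L) ⟩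
    2 ^ suc L                           ∎))
  where
  open ≡-Reasoning
  L = leadingOnes bs
... | inj₂ (r , len , upper , lower) = inj₂ (r , cong suc len ,
    subst₂ _≤_ (shift (2 ^ r)) (double len) (+-monoʳ-≤ (1 * 2 ^ length bs) upper) ,
    subst₂ _<_ (double len) (shift (2 ^ suc r)) (+-monoʳ-< (1 * 2 ^ length bs) lower))
  where
  shift : ∀ c → 1 * 2 ^ length bs + (suc (valueᴹ bs) + c) ≡ suc (1 * 2 ^ length bs + valueᴹ bs) + c
  shift c = trans (sym (+-assoc (1 * 2 ^ length bs) (suc (valueᴹ bs)) c)) (cong (_+ c) (+-suc (1 * 2 ^ length bs) (valueᴹ bs)))
  double : ∀ {k} → length bs ≡ k → 1 * 2 ^ length bs + 2 ^ k ≡ 2 ^ suc k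
  double {k} refl = +-comm (1 * 2 ^ k) (2 ^ k)

-- Halving `n` lowers both the exponent and the logarithm by one.
2^<⇒<⌈log₂⌉ : ∀ k {n} → 2 ^ k < n → k < ⌈log₂ n ⌉
2^<⇒<⌈log₂⌉ zero    1<n = ⌈log₂⌉-mono-≤ 1<n
2^<⇒<⌈log₂⌉ (suc k) {n} 2^1+k<n =
  1+-<-pred (subst (k <_) (⌈log₂⌈n/2⌉⌉≡⌈log₂n⌉∸1 n) (2^<⇒<⌈log₂⌉ k (≰⇒> half≰)))
  where
  1+-<-pred : ∀ {a b} → a < b ∸ 1 → suc a < b
  1+-<-pred {b = suc b} a<b = s≤s a<b
  half≰ : ¬ ⌈ n /2⌉ ≤ 2 ^ k
  half≰ half≤ = <⇒≱ 2^1+k<n (begin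
    n                     ≡⟨ ⌊n/2⌋+⌈n/2⌉≡n n ⟨
    ⌊ n /2⌋ + ⌈ n /2⌉     ≤⟨ +-mono-≤ (≤-trans (⌊n/2⌋≤⌈n/2⌉ n) half≤) half≤ ⟩
    2 ^ k + 2 ^ k         ≡⟨ cong (2 ^ k +_) (+-identityʳ (2 ^ k)) ⟨
    2 ^ suc k             ∎)
    where open ≤-Reasoning

-- This is the expansion of `0 ≤ (m - 1) * (n - 1)`.
m+n≤m*n+1 : ∀ {m n} → 0 < m → 0 < n → m + n ≤ m * n + 1
m+n≤m*n+1 {suc m} {suc n} _ _ = begin
  suc m + suc n             ≡⟨ solve 2 (λ m n → (con 1 :+ m) :+ (con 1 :+ n) := m :+ (con 2 :+ n)) refl m n ⟩
  m + (2 + n)               ≤⟨ +-monoˡ-≤ (2 + n) (m≤m*n m (suc n)) ⟩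
  m * suc n + (2 + n)       ≡⟨ solve 2 (λ m n → m :* (con 1 :+ n) :+ (con 2 :+ n) := (con 1 :+ m) :* (con 1 :+ n) :+ con 1) refl m n ⟩
  suc m * suc n + 1         ∎
  where
  open ≤-Reasoning
  open +-*-Solver

-- Choice of parameters and the edge constant.

Solution : ℕ → ℕ → Set
Solution L n = Σ (Graph n) λ G → Connected G × numEdges G ≤ 6 * n * L × BfaEq G ⌈log₂ n ⌉

cubeSolution : ∀ L → Solution L (2 ^ L)
cubeSolution L =
  let connected , optimal = bfaEq family {L} (m^n>0 2 L) completes (≤-reflexive (sym (⌈log₂2^n⌉≡n L)))
  in graph , connected , ≤-trans edges few , optimal
  where
  open Cube L {2 ^ L} (bits L ∘ toℕ)
    (λ {f} {g} eq → toℕ-injective (bits-injective L (toℕ<n f) (toℕ<n g) eq))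
    (λ x → fromℕ< (value<2^ x) , trans (cong (bits L) (toℕ-fromℕ< (value<2^ x))) (bits-value x))
  few : 2 ^ L * (L * 2) ≤ 6 * 2 ^ L * L
  few = begin
    2 ^ L * (L * 2)   ≡⟨ solve 2 (λ n l → n :* (l :* con 2) := con 2 :* n :* l) refl (2 ^ L) L ⟩
    2 * 2 ^ L * L     ≤⟨ *-monoˡ-≤ L (*-monoˡ-≤ (2 ^ L) {2} {6} (s≤s (s≤s z≤n))) ⟩
    6 * 2 ^ L * L     ∎
    where
    open ≤-Reasoning
    open +-*-Solver

coreTreeSolution : ∀ L r n → 1 ≤ L → n + 2 ^ r ≤ 2 ^ (suc L + r) → 2 ^ (suc L + r) < n + 2 ^ suc r → Solution L n
coreTreeSolution L r n 1≤L upper lower =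
  let connected , optimal = bfaEq family {r + d} (≤-trans (s≤s z≤n) 2^L+r<n) completes rounds
  in graph , connected , ≤-trans edges few , optimal
  where
  d = suc L
  M = pred (2 ^ d)
  2^d>0 : 0 < 2 ^ d
  2^d>0 = m^n>0 2 d
  1+M≡2^d : suc M ≡ 2 ^ d
  1+M≡2^d = suc-pred (2 ^ d) ⦃ ≢-nonZero (≢-sym (<⇒≢ 2^d>0)) ⦄
  1<2^d : 1 < 2 ^ d
  1<2^d = ^-monoʳ-≤ 2 {1} {d} (s≤s z≤n)
  instance
    M-nonZero : NonZero M
    M-nonZero = ≢-nonZero λ M≡0 → <⇒≢ 1<2^d (trans (cong suc (sym M≡0)) 1+M≡2^d)
  open ≤-Reasoning
  open +-*-Solver
  -- By `lower`, `n` exceeds `2 ^ (d + r) - 2 ^ suc r`, which is at least `2 ^ d - 2`; hence `n`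
  -- vertices fill the core.
  M≤n : M ≤ n
  M≤n = s≤s⁻¹ (+-cancelʳ-≤ (2 ^ suc r) (suc M) (suc n) (begin
    suc M + 2 ^ suc r            ≡⟨ cong (_+ 2 ^ suc r) 1+M≡2^d ⟩
    2 * 2 ^ L + 2 * 2 ^ r        ≡⟨ *-distribˡ-+ 2 (2 ^ L) (2 ^ r) ⟨
    2 * (2 ^ L + 2 ^ r)          ≤⟨ *-monoʳ-≤ 2 (m+n≤m*n+1 (m^n>0 2 L) (m^n>0 2 r)) ⟩
    2 * (2 ^ L * 2 ^ r + 1)      ≡⟨ cong (λ p → 2 * (p + 1)) (^-distribˡ-+-* 2 L r) ⟨
    2 * (2 ^ (L + r) + 1)        ≡⟨ solve 1 (λ p → con 2 :* (p :+ con 1) := con 1 :+ (con 1 :+ con 2 :* p)) refl (2 ^ (L + r)) ⟩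
    suc (suc (2 ^ (d + r)))      ≤⟨ s≤s lower ⟩
    suc n + 2 ^ suc r            ∎))
  n≤M2^r : n ≤ M * 2 ^ r
  n≤M2^r = +-cancelʳ-≤ (2 ^ r) n (M * 2 ^ r) (begin
    n + 2 ^ r           ≤⟨ upper ⟩
    2 ^ (d + r)         ≡⟨ ^-distribˡ-+-* 2 d r ⟩
    2 ^ d * 2 ^ r       ≡⟨ cong (_* 2 ^ r) 1+M≡2^d ⟨
    2 ^ r + M * 2 ^ r   ≡⟨ +-comm (2 ^ r) (M * 2 ^ r) ⟩
    M * 2 ^ r + 2 ^ r   ∎)
  open CoreTreeLabels d r M n 1+M≡2^d M≤n n≤M2^r using (graph; family; completes; edges)
  -- As `1 ≤ L`, the gap `2 ^ suc r` is at most half of `2 ^ (d + r)`. Thus the logarithm of `n`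
  -- rounds up to at least `d + r`.
  2^L+r<n : 2 ^ (L + r) < n
  2^L+r<n = +-cancelʳ-< (2 ^ (L + r)) (2 ^ (L + r)) n (begin-strict
    2 ^ (L + r) + 2 ^ (L + r) ≡⟨ cong (2 ^ (L + r) +_) (+-identityʳ (2 ^ (L + r))) ⟨
    2 ^ (d + r)               <⟨ lower ⟩
    n + 2 ^ suc r             ≤⟨ +-monoʳ-≤ n (^-monoʳ-≤ 2 (+-monoˡ-≤ r 1≤L)) ⟩
    n + 2 ^ (L + r)           ∎)
  rounds : r + d ≤ ⌈log₂ n ⌉
  rounds = subst (_≤ ⌈log₂ n ⌉) (+-comm d r) (2^<⇒<⌈log₂⌉ (L + r) 2^L+r<n)
  few : n * (suc d * 2) ≤ 6 * n * L
  few = begin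
    n * ((2 + L) * 2)       ≤⟨ *-monoʳ-≤ n (*-monoˡ-≤ 2 (+-monoˡ-≤ L (*-monoʳ-≤ 2 1≤L))) ⟩
    n * ((2 * L + L) * 2)   ≡⟨ solve 2 (λ n l → n :* ((con 2 :* l :+ l) :* con 2) := con 6 :* n :* l) refl n L ⟩
    6 * n * L               ∎

theorem2 : Σ ℕ λ C → C > 0 × (∀ (n : ℕ) → n ≥ 1 →
    Σ (Graph n) λ G → Connected G
    × numEdges G ≤ C * n * Lfun n
    × BfaEq G ⌈log₂ n ⌉)
-- The core with trees has at most `2 * (L + 2)` edges per vertex, which `1 ≤ L` bounds by `6 * L`;
-- for the cube `2 * L` suffices.
theorem2 = 6 , s≤s z≤n , solution
  where
  solution : ∀ n → n ≥ 1 → Solution (Lfun n) n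
  solution (suc m) _ with leadingOnes-split (binary m) | value-bitsLSB m m ≤-refl
  ... | inj₁ (_ , val) | val≡m =
        subst (Solution (Lfun (suc m))) (trans (sym val) (cong suc val≡m)) (cubeSolution (Lfun (suc m)))
  -- The representation of `0` has no digits, hence no zero after its leading ones.
  solution (suc zero)    _ | inj₂ (_ , () , _) | _
  solution (suc (suc m)) _ | inj₂ (r , _ , upper , lower) | val≡m =
    coreTreeSolution (Lfun (suc (suc m))) r (suc (suc m)) (leadingOnes-bitsLSB (suc m) m ≤-refl)
      (subst (λ v → suc v + 2 ^ r ≤ 2 ^ (suc (Lfun (suc (suc m))) + r)) val≡m upper)
      (subst (λ v → 2 ^ (suc (Lfun (suc (suc m))) + r) < suc v + 2 ^ suc r) val≡m lower)
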